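{- For every integer $n \geq 3$, $\gamma_{b,2}(C_3 \square C_n) = \left\lceil \frac{2n}{3} \right\rceil$.
   Context: For a graph $G$, a $2$-limited broadcast is a function $f: V(G) \to \{0,1,2\}$. A vertex $u$ hears the broadcast from $v$ if $f(v) > 0$ and $d(u,v) \leq f(v)$, where $d$ is the distance in $G$. The broadcast $f$ is dominating if every vertex of $G$ hears the broadcast from some vertex. The cost of $f$ is $\sum_{v \in V(G)} f(v)$. The $2$-limited broadcast domination number $\gamma_{b,2}(G)$ is the minimum cost of a $2$-limited dominating broadcast on $G$. $C_n$ denotes the cycle on $n$ vertices, $P_n$ the path on $n$ vertices, and $\square$ the Cartesian product of graphs. -}

module Defs where

open import Algebra.Properties.CommutativeMonoid.Sum using (sum)
open import Data.Fin using (Fin; toℕ)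
open import Data.Fin.Properties using (*↔×)
open import Data.Nat using (ℕ; suc; _*_; _≤_; _<_; _≥_; z≤n; s≤s)
open import Data.Nat.Properties using (+-0-commutativeMonoid; 1+n≢n)
open import Data.Product using (_×_; _,_; ∃-syntax)
open import Data.Product.Function.NonDependent.Propositional using (_×-↔_)
open import Data.Sum using (_⊎_; inj₁; inj₂; swap)
open import Function using (_∘_)
open import Function.Bundles using (_↔_; Inverse)
open import Function.Construct.Composition using (_↔-∘_)
open import Function.Construct.Identity using (↔-id)
open import Relation.Binary.Definitions using (Symmetric)
open import Relation.Binary.PropositionalEquality using (_≡_; cong; sym; trans)
open import Relation.Nullary using (¬_)

-- Finite simple graphs.

record Graph : Set₁ where
  field
    V           : Set
    _~_         : V → V → Set
    ~-sym       : Symmetric _~_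
    ~-irrefl    : ∀ {u} → ¬ (u ~ u)
    order       : ℕ
    -- The enumeration witnesses finiteness and is only used to sum over V.
    enumeration : Fin order ↔ V

-- `Next i j` is j = i + 1 modulo n.

Next : ∀ {n} → Fin n → Fin n → Set
Next {n} i j = suc (toℕ i) ≡ toℕ j ⊎ (suc (toℕ i) ≡ n × toℕ j ≡ 0)

Next-irrefl : ∀ {n} → n ≥ 3 → {i : Fin n} → ¬ Next i i
Next-irrefl _                     (inj₁ 1+i≡i)         = 1+n≢n 1+i≡i
Next-irrefl (s≤s (s≤s (s≤s z≤n))) (inj₂ (1+i≡n , i≡0)) with trans (sym 1+i≡n) (cong suc i≡0)
... | ()

C : (n : ℕ) → n ≥ 3 → Graph
C n n≥3 = record
  { V           = Fin n
  ; _~_         = λ i j → Next i j ⊎ Next j i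
  ; ~-sym       = swap
  ; ~-irrefl    = λ { (inj₁ p) → Next-irrefl n≥3 p ; (inj₂ p) → Next-irrefl n≥3 p }
  ; order       = n
  ; enumeration = ↔-id (Fin n)
  }

infixr 7 _□_

_□_ : Graph → Graph → Graph
G □ H = record
  { V           = G.V × H.V
  ; _~_         = λ (g , h) (g′ , h′) → (g ≡ g′ × h H.~ h′) ⊎ (g G.~ g′ × h ≡ h′)
  ; ~-sym       = λ { (inj₁ (p , q)) → inj₁ (sym p , H.~-sym q)
                    ; (inj₂ (p , q)) → inj₂ (G.~-sym p , sym q) }
  ; ~-irrefl    = λ { (inj₁ (_ , q)) → H.~-irrefl q
                    ; (inj₂ (p , _)) → G.~-irrefl p }
  ; order       = G.order * H.order
  ; enumeration = (G.enumeration ×-↔ H.enumeration) ↔-∘ *↔×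
  }
  where
  module G = Graph G
  module H = Graph H

module _ (G : Graph) where
  open Graph G

  -- Walks indexed by their number of edges.
  data Walk : V → V → ℕ → Set where
    []  : ∀ {u} → Walk u u 0
    _∷_ : ∀ {u v w k} → u ~ v → Walk v w k → Walk u w (suc k)

  -- d(u,v) = d. Vertices in different components have no distance, which
  -- plays the role of d(u,v) = ∞.
  IsDistance : V → V → ℕ → Set
  IsDistance u v d = Walk u v d × (∀ k → Walk u v k → d ≤ k)

  -- k-limited broadcasts V → {0,…,k}.
  Broadcast : ℕ → Set
  Broadcast k = V → Fin (suc k)

  module _ {k : ℕ} (f : Broadcast k) where

    -- u hears the broadcast from v.
    Hears : V → V → Set
    Hears u v = 0 < toℕ (f v) × ∃[ d ] (IsDistance u v d × d ≤ toℕ (f v))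

    Dominating : Set
    Dominating = ∀ u → ∃[ v ] Hears u v

    cost : ℕ
    cost = sum +-0-commutativeMonoid (toℕ ∘ f ∘ Inverse.to enumeration)

  -- γ_{b,k}(G) = m. As a minimum, the value m is unique; it is expressed as a
  -- relation because computing it would require deciding adjacency.
  IsBroadcastDominationNumber : ℕ → ℕ → Set
  IsBroadcastDominationNumber k m =
    (∃[ f ] (Dominating {k} f × cost f ≡ m)) ×
    (∀ (f : Broadcast k) → Dominating f → m ≤ cost f)

{-# OPTIONS --safe #-}
-- Lower bound, by discharging between the columns {0,1,2} × {j}.  Count in units
-- of 2/3.  A column of cost c > 0 keeps one unit; towards each side it sends one
-- unit if c ≥ 2, to the adjacent column if that one is empty and to the next one
-- otherwise, and it sends a unit to both of these columns if c ≥ 4.  This spends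
-- at most c.  Suppose that an empty column has no column of cost ≥ 2 beside it.
-- Then each of its three vertices hears a vertex of the same row at distance 1, or
-- one of strength 2 at distance 2, and two of the three lie on the same side: that
-- side has cost ≥ 4 at distance 2, or cost ≥ 1 at distance 1 and ≥ 2 at distance 2,
-- and so it sends a unit.  Every column thus ends with at least 2/3.
--
-- Upper bound: strength 2 in row 0 at the columns ≡ 1 (mod 3), and strength 1 in the
-- last column if n ≡ 1 (mod 3).
module Submission where

open import Defs
import Algebra.Properties.CommutativeMonoid.Sum
open import Data.Fin using (Fin; zero; suc; toℕ; fromℕ; fromℕ<; inject₁; _↑ˡ_; _↑ʳ_; combine; remQuot)
open import Data.Fin.Patterns using (0F; 1F; 2F)
open import Data.Fin.Permutation as Perm using (Permutation′; permutation; flip; _⟨$⟩ʳ_; _⟨$⟩ˡ_)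
open import Data.Fin.Properties
  using (toℕ-injective; toℕ-fromℕ; toℕ-fromℕ<; toℕ-inject₁; toℕ<n; toℕ≤pred[n]; remQuot-combine)
open import Data.Nat
  using (ℕ; zero; suc; _+_; _*_; _≤_; _<_; _≥_; z≤n; s≤s; z<s; s≤s⁻¹; NonZero; _<?_)
open import Data.Nat.DivMod as ℕ using (m≡m%n+[m/n]*n; m%n<n)
open import Data.Nat.Properties
open import Data.Product using (_×_; _,_; proj₁; proj₂; ∃-syntax)
open import Data.Rational.Unnormalised using (ceiling; _/_)
open import Data.Sum using (_⊎_; inj₁; inj₂)
open import Function using (_∘_)
open import Relation.Binary.PropositionalEquality
  using (_≡_; _≢_; refl; sym; trans; cong; cong₂; subst)
open import Relation.Nullary using (yes; no; contradiction)

-- Finite sums of naturals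

module Sum = Algebra.Properties.CommutativeMonoid.Sum +-0-commutativeMonoid

∑ : ∀ {n} → (Fin n → ℕ) → ℕ
∑ = Sum.sum

∑-mono-≤ : ∀ {n} {f g : Fin n → ℕ} → (∀ i → f i ≤ g i) → ∑ f ≤ ∑ g
∑-mono-≤ {zero}  f≤g = z≤n
∑-mono-≤ {suc n} f≤g = +-mono-≤ (f≤g zero) (∑-mono-≤ (f≤g ∘ suc))

n≤∑ : ∀ {n} {f : Fin n → ℕ} → (∀ i → 1 ≤ f i) → n ≤ ∑ f
n≤∑ {zero}  1≤f = z≤n
n≤∑ {suc n} 1≤f = +-mono-≤ (1≤f zero) (n≤∑ (1≤f ∘ suc))

∑-distribˡ-* : ∀ {n} k (f : Fin n → ℕ) → ∑ (λ i → k * f i) ≡ k * ∑ f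
∑-distribˡ-* {zero}  k f = sym (*-zeroʳ k)
∑-distribˡ-* {suc n} k f =
  trans (cong (k * f zero +_) (∑-distribˡ-* k (f ∘ suc))) (sym (*-distribˡ-+ k (f zero) _))

f[i]≤∑f : ∀ {n} (f : Fin n → ℕ) i → f i ≤ ∑ f
f[i]≤∑f f zero    = m≤m+n _ _
f[i]≤∑f f (suc i) = ≤-trans (f[i]≤∑f (f ∘ suc) i) (m≤n+m _ _)

f[i]+f[j]≤∑f : ∀ {n} (f : Fin n → ℕ) {i j} → i ≢ j → f i + f j ≤ ∑ f
f[i]+f[j]≤∑f f {zero}  {zero}  i≢j = contradiction refl i≢j
f[i]+f[j]≤∑f f {zero}  {suc j} i≢j = +-monoʳ-≤ _ (f[i]≤∑f (f ∘ suc) j)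
f[i]+f[j]≤∑f f {suc i} {zero}  i≢j =
  ≤-trans (≤-reflexive (+-comm (f (suc i)) _)) (+-monoʳ-≤ _ (f[i]≤∑f (f ∘ suc) i))
f[i]+f[j]≤∑f f {suc i} {suc j} i≢j =
  ≤-trans (f[i]+f[j]≤∑f (f ∘ suc) (i≢j ∘ cong suc)) (m≤n+m _ _)

∑-+ : ∀ m {n} (f : Fin (m + n) → ℕ) → ∑ f ≡ ∑ (f ∘ (_↑ˡ n)) + ∑ (f ∘ (m ↑ʳ_))
∑-+ zero    f = refl
∑-+ (suc m) f = trans (cong (f zero +_) (∑-+ m (f ∘ suc))) (sym (+-assoc (f zero) _ _))

∑-combine : ∀ m {n} (f : Fin (m * n) → ℕ) → ∑ f ≡ ∑ (λ i → ∑ (λ j → f (combine {m} i j)))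
∑-combine zero        f = refl
∑-combine (suc m) {n} f = trans (∑-+ n f) (cong (∑ (f ∘ (_↑ˡ (m * n))) +_) (∑-combine m (f ∘ (n ↑ʳ_))))

-- The enumeration of a product graph goes through `remQuot`; this turns the cost of a broadcast on
-- it into a double sum.
∑-remQuot : ∀ m {n} (f : Fin m × Fin n → ℕ) →
            ∑ (f ∘ remQuot {m} n) ≡ ∑ (λ i → ∑ (λ j → f (i , j)))
∑-remQuot m {n} f = trans (∑-combine m (f ∘ remQuot {m} n))
  (Sum.sum-cong-≗ λ i → Sum.sum-cong-≗ λ j → cong f (remQuot-combine i j))

-- The cyclic successor as a permutation

Next-functional : ∀ {n} {i j k : Fin n} → Next i j → Next i k → j ≡ k
Next-functional         (inj₁ p)       (inj₁ q)       = toℕ-injective (trans (sym p) q)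
Next-functional {j = j} (inj₁ p)       (inj₂ (q , _)) = contradiction (trans (sym p) q) (<⇒≢ (toℕ<n j))
Next-functional {k = k} (inj₂ (p , _)) (inj₁ q)       = contradiction (trans (sym q) p) (<⇒≢ (toℕ<n k))
Next-functional         (inj₂ (_ , p)) (inj₂ (_ , q)) = toℕ-injective (trans p (sym q))

Next-injective : ∀ {n} {i j k : Fin n} → Next i k → Next j k → i ≡ j
Next-injective (inj₁ p)       (inj₁ q)       = toℕ-injective (suc-injective (trans p (sym q)))
Next-injective (inj₁ p)       (inj₂ (_ , q)) = contradiction (trans p q) λ()
Next-injective (inj₂ (_ , p)) (inj₁ q)       = contradiction (trans q p) λ()
Next-injective (inj₂ (p , _)) (inj₂ (q , _)) = toℕ-injective (suc-injective (trans p (sym q)))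

successor : ∀ {n} (i : Fin n) → ∃[ j ] Next i j
successor {suc m} i with toℕ i <? m
... | yes i<m = fromℕ< (s≤s i<m) , inj₁ (sym (toℕ-fromℕ< (s≤s i<m)))
... | no  i≮m = zero , inj₂ (cong suc (≤-antisym (toℕ≤pred[n] i) (≮⇒≥ i≮m)) , refl)

predecessor : ∀ {n} (j : Fin n) → ∃[ i ] Next i j
predecessor {suc m} zero    = fromℕ m , inj₂ (cong suc (toℕ-fromℕ m) , refl)
predecessor {suc m} (suc j) = inject₁ j , inj₁ (cong suc (toℕ-inject₁ j))

-- As a permutation it allows reindexing of sums, and its `flip` gives the opposite direction, so
-- both sides of a column share one argument.
rotate : ∀ {n} → Permutation′ n
rotate = permutation (proj₁ ∘ successor) (proj₁ ∘ predecessor)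
  (λ j → Next-functional (proj₂ (successor _)) (proj₂ (predecessor j)))
  (λ i → Next-injective (proj₂ (predecessor _)) (proj₂ (successor i)))

cyclic-neighbours : ∀ {n} {i j : Fin n} → Next i j ⊎ Next j i →
                    j ≡ rotate ⟨$⟩ʳ i ⊎ j ≡ rotate ⟨$⟩ˡ i
cyclic-neighbours (inj₁ i→j) = inj₁ (Next-functional i→j (proj₂ (successor _)))
cyclic-neighbours (inj₂ j→i) = inj₂ (Next-injective j→i (proj₂ (predecessor _)))

-- Units kept and sent by a column

-- Units kept by a column of cost c, and sent on one side to the columns at distance 1
-- and 2 when the former has cost d.

kept : ℕ → ℕ
kept zero    = 0
kept (suc _) = 1

near : (c d : ℕ) → ℕ
near 0 _ = 0
near 1 _ = 0
near (suc (suc _)) zero = 1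
near (suc (suc (suc (suc _)))) (suc _) = 1
near _ _ = 0

far : (c d : ℕ) → ℕ
far 0 _ = 0
far 1 _ = 0
far (suc (suc _)) (suc _) = 1
far (suc (suc (suc (suc _)))) zero = 1
far _ _ = 0

sent : ℕ → ℕ
sent 0 = 0
sent 1 = 0
sent 2 = 1
sent 3 = 1
sent _ = 2

near+far≤sent : ∀ c d → near c d + far c d ≤ sent c
near+far≤sent 0 d = z≤n
near+far≤sent 1 d = z≤n
near+far≤sent 2 zero = ≤-refl
near+far≤sent 2 (suc d) = ≤-refl
near+far≤sent 3 zero = ≤-refl
near+far≤sent 3 (suc d) = ≤-refl
near+far≤sent (suc (suc (suc (suc c)))) zero = ≤-refl
near+far≤sent (suc (suc (suc (suc c)))) (suc d) = ≤-refl

-- A unit is worth 2/3, hence the factors 2 and 3. Equality holds at cost 2; from cost 4 on, one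
-- unit kept and four sent give 10, against at least 12.
spent≤cost : ∀ c → 2 * (kept c + (sent c + sent c)) ≤ 3 * c
spent≤cost 0 = z≤n
spent≤cost 1 = m≤m+n 2 1
spent≤cost 2 = ≤-refl
spent≤cost 3 = m≤m+n 6 3
spent≤cost (suc (suc (suc (suc c)))) =
  ≤-trans (m≤m+n 10 2) (*-monoʳ-≤ 3 (m≤m+n 4 c))

far-positive : ∀ {c d} → 4 ≤ c → 1 ≤ far c d
far-positive {d = zero}  (s≤s (s≤s (s≤s (s≤s _)))) = ≤-refl
far-positive {d = suc _} (s≤s (s≤s (s≤s (s≤s _)))) = ≤-refl

far-positive′ : ∀ {c d} → 2 ≤ c → 1 ≤ d → 1 ≤ far c d
far-positive′ (s≤s (s≤s _)) (s≤s _) = ≤-refl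

near-positive : ∀ {c} → 2 ≤ c → 1 ≤ near c 0
near-positive (s≤s (s≤s _)) = ≤-refl

-- Discharging along a permutation

module _ {n : ℕ} (c : Fin n → ℕ) where

  -- `π` is the direction in which the senders lie. The sender two steps away sees the column one
  -- step away as its adjacent one.
  received : Permutation′ n → Fin n → ℕ
  received π j = near (c (π ⟨$⟩ʳ j)) (c j) + far (c (π ⟨$⟩ʳ (π ⟨$⟩ʳ j))) (c (π ⟨$⟩ʳ j))

  -- Double counting: the sum over receivers is reindexed over senders, by one shift for `near` and
  -- by two for `far`.
  ∑-received≤∑-sent : ∀ π → ∑ (received π) ≤ ∑ (sent ∘ c)
  ∑-received≤∑-sent π = begin
    ∑ (received π)                                ≡⟨ Sum.∑-distrib-+ (λ j → near (c (p j)) (c j)) _ ⟩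
    ∑ (λ j → near (c (p j)) (c j)) + ∑ (λ j → far (c (p (p j))) (c (p j)))
                                                  ≡⟨ cong₂ _+_ (shift near) (trans (sym (Sum.sum-permute (λ j → far (c (p j)) (c j)) π)) (shift far)) ⟩
    ∑ (λ j → near (c j) (c (q j))) + ∑ (λ j → far (c j) (c (q j)))
                                                  ≡⟨ Sum.∑-distrib-+ (λ j → near (c j) (c (q j))) _ ⟨
    ∑ (λ j → near (c j) (c (q j)) + far (c j) (c (q j)))
                                                  ≤⟨ ∑-mono-≤ (λ j → near+far≤sent (c j) (c (q j))) ⟩
    ∑ (sent ∘ c)                                  ∎
    where
    open ≤-Reasoning
    p q : Fin n → Fin n
    p = π ⟨$⟩ʳ_
    q = π ⟨$⟩ˡ_
    shift : (s : ℕ → ℕ → ℕ) → ∑ (λ j → s (c (p j)) (c j)) ≡ ∑ (λ j → s (c j) (c (q j)))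
    shift s = sym (trans (Sum.sum-permute (λ j → s (c j) (c (q j))) π)
      (Sum.sum-cong-≗ λ j → cong (s (c (p j)) ∘ c) (Perm.inverseˡ π)))

  discharging : ∀ π → (∀ j → c j ≡ 0 → 1 ≤ received π j + received (flip π) j) → 2 * n ≤ 3 * ∑ c
  discharging π served = begin
    2 * n                                          ≤⟨ *-monoʳ-≤ 2 (n≤∑ final) ⟩
    2 * ∑ (λ j → kept (c j) + (received π j + received (flip π) j))
      ≡⟨ cong (2 *_) (distrib (kept ∘ c) (received π) (received (flip π))) ⟩
    2 * (∑ (kept ∘ c) + (∑ (received π) + ∑ (received (flip π))))
      ≤⟨ *-monoʳ-≤ 2 (+-monoʳ-≤ (∑ (kept ∘ c)) (+-mono-≤ (∑-received≤∑-sent π) (∑-received≤∑-sent (flip π)))) ⟩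
    2 * (∑ (kept ∘ c) + (∑ (sent ∘ c) + ∑ (sent ∘ c)))
      ≡⟨ cong (2 *_) (distrib (kept ∘ c) (sent ∘ c) (sent ∘ c)) ⟨
    2 * ∑ (λ j → kept (c j) + (sent (c j) + sent (c j)))
      ≡⟨ ∑-distribˡ-* 2 (λ j → kept (c j) + (sent (c j) + sent (c j))) ⟨
    ∑ (λ j → 2 * (kept (c j) + (sent (c j) + sent (c j))))
      ≤⟨ ∑-mono-≤ (spent≤cost ∘ c) ⟩
    ∑ (λ j → 3 * c j)                              ≡⟨ ∑-distribˡ-* 3 c ⟩
    3 * ∑ c                                        ∎
    where
    open ≤-Reasoning
    distrib : (f g h : Fin n → ℕ) → ∑ (λ j → f j + (g j + h j)) ≡ ∑ f + (∑ g + ∑ h)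
    distrib f g h = trans (Sum.∑-distrib-+ f _) (cong (∑ f +_) (Sum.∑-distrib-+ g h))
    final : ∀ j → 1 ≤ kept (c j) + (received π j + received (flip π) j)
    final j with c j in cj≡
    ... | suc _ = m≤m+n 1 _
    -- The abstraction has replaced `c j` by `zero` in the goal but not in `served`, which is
    -- transported along `cj≡`.
    ... | zero  = subst (λ d → 1 ≤ near (c (π ⟨$⟩ʳ j)) d + far (c (π ⟨$⟩ʳ (π ⟨$⟩ʳ j))) (c (π ⟨$⟩ʳ j))
                             + (near (c (π ⟨$⟩ˡ j)) d + far (c (π ⟨$⟩ˡ (π ⟨$⟩ˡ j))) (c (π ⟨$⟩ˡ j))))
                        cj≡ (served j cj≡)

-- Lower bound: empty columns are served

-- Pigeonhole for three rows and two sides. The two rows are distinct so that their strengths can be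
-- added.
two-on-one-side : {P Q : Fin 3 → Set} → (∀ i → P i ⊎ Q i) →
                  (∃[ i ] ∃[ j ] (i ≢ j × P i × P j)) ⊎ (∃[ i ] ∃[ j ] (i ≢ j × Q i × Q j))
two-on-one-side side with side 0F | side 1F | side 2F
... | inj₁ a | inj₁ b | _      = inj₁ (0F , 1F , (λ()) , a , b)
... | inj₁ a | inj₂ _ | inj₁ b = inj₁ (0F , 2F , (λ()) , a , b)
... | inj₂ _ | inj₁ a | inj₁ b = inj₁ (1F , 2F , (λ()) , a , b)
... | inj₂ a | inj₂ b | _      = inj₂ (0F , 1F , (λ()) , a , b)
... | inj₂ a | inj₁ _ | inj₂ b = inj₂ (0F , 2F , (λ()) , a , b)
... | inj₁ _ | inj₂ a | inj₂ b = inj₂ (1F , 2F , (λ()) , a , b)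

module _ {n : ℕ} (n≥3 : n ≥ 3) where

  private
    G : Graph
    G = C 3 ≤-refl □ C n n≥3

  module _ (f : Broadcast G 2) where

    column : Fin n → ℕ
    column j = ∑ (λ r → toℕ (f (r , j)))

    cost≡∑-column : cost G f ≡ ∑ column
    cost≡∑-column = trans (∑-remQuot 3 (toℕ ∘ f)) (Sum.∑-comm {3} (λ r j → toℕ (f (r , j))))

    strength≤column : ∀ r j → toℕ (f (r , j)) ≤ column j
    strength≤column r j = f[i]≤∑f (λ r → toℕ (f (r , j))) r

    -- The ways to be reached from one side: diagonally by strength 2, where only the cost of the
    -- adjacent column is retained, or along row `r` from distance 1 or 2.
    HeardFrom : Permutation′ n → Fin n → Fin 3 → Set
    HeardFrom π j r = 2 ≤ column (π ⟨$⟩ʳ j)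
                    ⊎ 1 ≤ toℕ (f (r , π ⟨$⟩ʳ j))
                    ⊎ 2 ≤ toℕ (f (r , π ⟨$⟩ʳ (π ⟨$⟩ʳ j)))

    -- Case analysis on the edges of the walk: a step within a column preserves `j`, and a step
    -- along a row moves to one of the two sides.
    column-or-side : ∀ {r j s i d} → Walk G (r , j) (s , i) d →
                     0 < toℕ (f (s , i)) → d ≤ toℕ (f (s , i)) →
                     1 ≤ column j ⊎ HeardFrom rotate j r ⊎ HeardFrom (flip rotate) j r
    column-or-side [] pos _ = inj₁ (≤-trans pos (strength≤column _ _))
    column-or-side (inj₂ (_ , refl) ∷ []) pos _ = inj₁ (≤-trans pos (strength≤column _ _))
    column-or-side (inj₁ (refl , a) ∷ []) pos _ with cyclic-neighbours a
    ... | inj₁ refl = inj₂ (inj₁ (inj₂ (inj₁ pos)))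
    ... | inj₂ refl = inj₂ (inj₂ (inj₂ (inj₁ pos)))
    column-or-side (inj₂ (_ , refl) ∷ (inj₂ (_ , refl) ∷ [])) pos _ =
      inj₁ (≤-trans pos (strength≤column _ _))
    column-or-side (inj₂ (_ , refl) ∷ (inj₁ (refl , a) ∷ [])) _ d≤ with cyclic-neighbours a
    ... | inj₁ refl = inj₂ (inj₁ (inj₁ (≤-trans d≤ (strength≤column _ _))))
    ... | inj₂ refl = inj₂ (inj₂ (inj₁ (≤-trans d≤ (strength≤column _ _))))
    column-or-side (inj₁ (refl , a) ∷ (inj₂ (_ , refl) ∷ [])) _ d≤ with cyclic-neighbours a
    ... | inj₁ refl = inj₂ (inj₁ (inj₁ (≤-trans d≤ (strength≤column _ _))))
    ... | inj₂ refl = inj₂ (inj₂ (inj₁ (≤-trans d≤ (strength≤column _ _))))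
    column-or-side {r} {j} (inj₁ (refl , a) ∷ (inj₁ (refl , b) ∷ [])) pos d≤
      with cyclic-neighbours a | cyclic-neighbours b
    ... | inj₁ refl | inj₁ refl = inj₂ (inj₁ (inj₂ (inj₂ d≤)))
    ... | inj₂ refl | inj₂ refl = inj₂ (inj₂ (inj₂ (inj₂ d≤)))
    -- One step out and one step back: the walk ends in column `j` itself.
    ... | inj₁ refl | inj₂ refl =
      inj₁ (subst (λ i → 1 ≤ column i) (Perm.inverseˡ rotate) (≤-trans pos (strength≤column r _)))
    ... | inj₂ refl | inj₁ refl =
      inj₁ (subst (λ i → 1 ≤ column i) (Perm.inverseʳ rotate) (≤-trans pos (strength≤column r _)))
    -- Three or more edges exceed every strength, which is at most 2.
    column-or-side {s = s} {i} (_ ∷ (_ ∷ (_ ∷ _))) _ d≤ =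
      contradiction (≤-trans (s≤s (s≤s (s≤s z≤n))) d≤) (<⇒≱ (toℕ<n (f (s , i))))

    -- Strengths in distinct rows of one column add up: 1 + 1 beside `j` suffices for `near`, and 2
    -- + 2 two steps away for `far`. In the mixed case the column beside `j` is nonempty, so a cost
    -- of 2 behind it already sends a unit to `j`.
    received-positive : ∀ π {j r s} → column j ≡ 0 → r ≢ s →
                        HeardFrom π j r → HeardFrom π j s → 1 ≤ received column π j
    received-positive π {j} {r} {s} empty r≢s = combined
      where
      one : ∀ {k r i} → k ≤ toℕ (f (r , i)) → k ≤ column i
      one k≤ = ≤-trans k≤ (strength≤column _ _)
      two : ∀ {k l i} → k ≤ toℕ (f (r , i)) → l ≤ toℕ (f (s , i)) → k + l ≤ column i
      two {i = i} k≤ l≤ = ≤-trans (+-mono-≤ k≤ l≤) (f[i]+f[j]≤∑f (λ r → toℕ (f (r , i))) r≢s)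
      viaNear : 2 ≤ column (π ⟨$⟩ʳ j) → 1 ≤ received column π j
      viaNear 2≤ = ≤-trans
        (subst (λ d → 1 ≤ near (column (π ⟨$⟩ʳ j)) d) (sym empty) (near-positive 2≤)) (m≤m+n _ _)
      viaFar : 1 ≤ far (column (π ⟨$⟩ʳ (π ⟨$⟩ʳ j))) (column (π ⟨$⟩ʳ j)) → 1 ≤ received column π j
      viaFar 1≤ = ≤-trans 1≤ (m≤n+m _ (near (column (π ⟨$⟩ʳ j)) (column j)))
      combined : HeardFrom π j r → HeardFrom π j s → 1 ≤ received column π j
      combined (inj₁ a)        _               = viaNear a
      combined (inj₂ _)        (inj₁ b)        = viaNear b
      combined (inj₂ (inj₁ a)) (inj₂ (inj₁ b)) = viaNear (two a b)
      combined (inj₂ (inj₁ a)) (inj₂ (inj₂ b)) = viaFar (far-positive′ (one b) (one a))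
      combined (inj₂ (inj₂ a)) (inj₂ (inj₁ b)) = viaFar (far-positive′ (one a) (one b))
      combined (inj₂ (inj₂ a)) (inj₂ (inj₂ b)) = viaFar (far-positive (two a b))

    empty-column-served : Dominating G f → ∀ j → column j ≡ 0 →
                          1 ≤ received column rotate j + received column (flip rotate) j
    empty-column-served dom j empty with two-on-one-side side
      where
      side : ∀ r → HeardFrom rotate j r ⊎ HeardFrom (flip rotate) j r
      side r with dom (r , j)
      ... | _ , pos , _ , (walk , _) , d≤ with column-or-side walk pos d≤
      ... | inj₁ 1≤ = contradiction empty (>⇒≢ 1≤)
      ... | inj₂ s  = s
    ... | inj₁ (_ , _ , r≢s , a , b) = ≤-trans (received-positive rotate empty r≢s a b) (m≤m+n _ _)
    ... | inj₂ (_ , _ , r≢s , a , b) =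
      ≤-trans (received-positive (flip rotate) empty r≢s a b) (m≤n+m _ (received column rotate j))

    dominating⇒2n≤3cost : Dominating G f → 2 * n ≤ 3 * cost G f
    dominating⇒2n≤3cost dom = subst (λ x → 2 * n ≤ 3 * x) (sym cost≡∑-column)
      (discharging column rotate (empty-column-served dom))

-- Distances 0, 1 and 2

module _ {G : Graph} where
  open Graph G

  ≡-distance : ∀ {u} → IsDistance G u u 0
  ≡-distance = [] , λ _ _ → z≤n

  ~-distance : ∀ {u v} → u ~ v → IsDistance G u v 1
  ~-distance u~v = u~v ∷ [] , λ where
    _ []      → contradiction u~v ~-irrefl
    _ (_ ∷ _) → s≤s z≤n

module _ {G H : Graph} where
  private
    module G = Graph G
    module H = Graph H

  ~×~-distance : ∀ {g g′ h h′} → g G.~ g′ → h H.~ h′ → IsDistance (G □ H) (g , h) (g′ , h′) 2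
  ~×~-distance g~g′ h~h′ = inj₂ (g~g′ , refl) ∷ (inj₁ (refl , h~h′) ∷ []) , λ where
    -- A walk with at most one edge fixes a coordinate, but both coordinates change here.
    _ []                           → contradiction g~g′ G.~-irrefl
    _ (inj₁ (refl , _) ∷ [])       → contradiction g~g′ G.~-irrefl
    _ (inj₂ (_ , refl) ∷ [])       → contradiction h~h′ H.~-irrefl
    _ (_ ∷ (_ ∷ _))                → s≤s (s≤s z≤n)

-- Upper bound: a periodic broadcast

-- The implicit argument counts the columns left, so the recursion by blocks 0, 2, 0 detects a
-- single leftover column.
strength : ∀ {n} → Fin n → Fin 3
strength {1}           zero                = 1F
strength {suc (suc _)} zero                = 0F
strength               (suc zero)          = 2F
strength               (suc (suc zero))    = 0F
strength               (suc (suc (suc i))) = strength i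

-- A block of three columns costs 2 and adds 6 to both sides. With the strict upper bound below,
-- this pins the cost to the ceiling of 2n/3.
∑-strength-lower : ∀ n → 2 * n ≤ 3 * ∑ {n} (toℕ ∘ strength)
∑-strength-lower 0 = z≤n
∑-strength-lower 1 = m≤m+n 2 1
∑-strength-lower 2 = m≤m+n 4 2
∑-strength-lower (suc (suc (suc n))) = begin
  2 * (3 + n)                              ≡⟨ *-distribˡ-+ 2 3 n ⟩
  6 + 2 * n                                ≤⟨ +-monoʳ-≤ 6 (∑-strength-lower n) ⟩
  6 + 3 * ∑ {n} (toℕ ∘ strength)           ≡⟨ *-distribˡ-+ 3 2 (∑ {n} (toℕ ∘ strength)) ⟨
  3 * (2 + ∑ {n} (toℕ ∘ strength))         ∎
  where open ≤-Reasoning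

∑-strength-upper : ∀ n → 3 * ∑ {n} (toℕ ∘ strength) < 2 * n + 3
∑-strength-upper 0 = z<s
∑-strength-upper 1 = m≤m+n 4 1
∑-strength-upper 2 = ≤-refl
∑-strength-upper (suc (suc (suc n))) = begin-strict
  3 * (2 + ∑ {n} (toℕ ∘ strength))         ≡⟨ *-distribˡ-+ 3 2 (∑ {n} (toℕ ∘ strength)) ⟩
  6 + 3 * ∑ {n} (toℕ ∘ strength)           <⟨ +-monoʳ-< 6 (∑-strength-upper n) ⟩
  6 + (2 * n + 3)                          ≡⟨ cong (_+ 3) (*-distribˡ-+ 2 3 n) ⟨
  2 * (3 + n) + 3                          ∎
  where open ≤-Reasoning

-- Neighbours are compared as numbers, without wrap-around, so the relation survives the shift by a
-- block of three.
strength-covers : ∀ {n} (i : Fin n) → strength i ≡ 1F ⊎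
  ∃[ j ] (strength j ≡ 2F × (i ≡ j ⊎ suc (toℕ i) ≡ toℕ j ⊎ suc (toℕ j) ≡ toℕ i))
strength-covers {1}           zero             = inj₁ refl
strength-covers {suc (suc _)} zero             = inj₂ (1F , refl , inj₂ (inj₁ refl))
strength-covers               (suc zero)       = inj₂ (1F , refl , inj₁ refl)
strength-covers               (suc (suc zero)) = inj₂ (1F , refl , inj₂ (inj₂ refl))
strength-covers               (suc (suc (suc i))) with strength-covers i
... | inj₁ p                       = inj₁ p
... | inj₂ (j , p , inj₁ e)        = inj₂ (suc (suc (suc j)) , p , inj₁ (cong (λ k → suc (suc (suc k))) e))
... | inj₂ (j , p , inj₂ (inj₁ e)) = inj₂ (suc (suc (suc j)) , p , inj₂ (inj₁ (cong (3 +_) e)))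
... | inj₂ (j , p , inj₂ (inj₂ e)) = inj₂ (suc (suc (suc j)) , p , inj₂ (inj₂ (cong (3 +_) e)))

module _ {n : ℕ} (n≥3 : n ≥ 3) where

  private
    G : Graph
    G = C 3 ≤-refl □ C n n≥3

  broadcast : Broadcast G 2
  broadcast (zero  , j) = strength j
  broadcast (suc _ , j) = 0F

  broadcast-cost : cost G broadcast ≡ ∑ {n} (toℕ ∘ strength)
  broadcast-cost = trans (∑-remQuot 3 (toℕ ∘ broadcast))
    (trans (cong (∑ {n} (toℕ ∘ strength) +_) (cong₂ _+_ (Sum.sum-replicate-zero n)
      (cong (_+ 0) (Sum.sum-replicate-zero n)))) (+-identityʳ _))

  hears : ∀ {u j s d} → strength j ≡ s → 0 < toℕ s → IsDistance G u (0F , j) d → d ≤ toℕ s →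
          Hears G broadcast u (0F , j)
  hears refl pos dist d≤ = pos , _ , dist , d≤

  suc~zero : ∀ (r : Fin 2) → Graph._~_ (C 3 ≤-refl) (suc r) 0F
  suc~zero 0F = inj₂ (inj₁ refl)
  suc~zero 1F = inj₁ (inj₂ (refl , refl))

  hears-in-column : ∀ {j s} r → strength j ≡ s → 0 < toℕ s → Hears G broadcast (r , j) (0F , j)
  hears-in-column zero    e pos = hears e pos (≡-distance {G}) z≤n
  hears-in-column (suc r) e pos = hears e pos (~-distance {G} (inj₂ (suc~zero r , refl))) pos

  -- Row 0 of the adjacent column is at distance 1 and the other two rows are at distance 2, so
  -- strength 2 reaches them all.
  hears-beside : ∀ {i j} r → strength j ≡ 2F → Graph._~_ (C n n≥3) i j →
                 Hears G broadcast (r , i) (0F , j)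
  hears-beside zero    e a = hears e z<s (~-distance {G} (inj₁ (refl , a))) (s≤s z≤n)
  hears-beside (suc r) e a =
    hears e z<s (~×~-distance {C 3 ≤-refl} {C n n≥3} (suc~zero r) a) ≤-refl

  broadcast-dominating : Dominating G broadcast
  broadcast-dominating (r , i) with strength-covers i
  ... | inj₁ e                          = (0F , i) , hears-in-column r e z<s
  ... | inj₂ (j , e , inj₁ refl)        = (0F , i) , hears-in-column r e z<s
  ... | inj₂ (j , e , inj₂ (inj₁ i⋖j)) = (0F , j) , hears-beside r e (inj₁ (inj₁ i⋖j))
  ... | inj₂ (j , e , inj₂ (inj₂ j⋖i)) = (0F , j) , hears-beside r e (inj₂ (inj₁ j⋖i))

-- The ceiling characterised by two inequalities

open import Data.Integer as ℤ using (+_; -[1+_])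
import Data.Integer.Properties as ℤ

ceiling-unique : ∀ k d .{{_ : NonZero d}} {γ} →
                 k ≤ γ * d → γ * d < k + d → + γ ≡ ceiling (+ k / d)
ceiling-unique zero d@(suc _) {γ} _ γd<d =
  cong +_ (n<1⇒n≡0 (*-cancelʳ-< d γ 1 (<-≤-trans γd<d (m≤m+n d 0))))
ceiling-unique k@(suc k-1) d@(suc _) {γ} k≤γd γd<k+d
  -- The ceiling unfolds to minus the integer quotient of `- k` by `d`. The rewrite clears the sign
  -- factor 1 of the divisor; the quotient then branches on whether `d` divides `k`.
  rewrite ℤ.*-identityˡ (-[1+ k-1 ] ℤ./ℕ d)
  with k ℕ.% d | m≡m%n+[m/n]*n k d | m%n<n k d
... | zero  | k≡qd | _ =
  trans (cong +_ (≤-antisym γ≤q q≤γ)) (sym (ℤ.neg-involutive (+ q)))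
  where
  q = k ℕ./ d
  q≤γ : q ≤ γ
  q≤γ = *-cancelʳ-≤ q γ d (subst (_≤ γ * d) k≡qd k≤γd)
  γ≤q : γ ≤ q
  γ≤q = s≤s⁻¹ (*-cancelʳ-< d γ (suc q) (<-≤-trans γd<k+d
    (≤-reflexive (trans (cong (_+ d) k≡qd) (+-comm (q * d) d)))))
... | suc r | k≡r+qd | r<d = cong +_ (≤-antisym γ≤1+q q<γ)
  where
  q = k ℕ./ d
  q<γ : q < γ
  q<γ = *-cancelʳ-< d q γ (<-≤-trans (s≤s (m≤n+m (q * d) r)) (subst (_≤ γ * d) k≡r+qd k≤γd))
  γ≤1+q : γ ≤ suc q
  γ≤1+q = s≤s⁻¹ (*-cancelʳ-< d γ (2 + q) (begin-strict
    γ * d                <⟨ γd<k+d ⟩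
    k + d                ≡⟨ cong (_+ d) k≡r+qd ⟩
    suc r + q * d + d    ≤⟨ +-monoˡ-≤ d (+-monoˡ-≤ (q * d) (<⇒≤ r<d)) ⟩
    d + q * d + d        ≡⟨ +-comm (d + q * d) d ⟩
    (2 + q) * d          ∎))
    where open ≤-Reasoning

theorem4p1 : (n : ℕ) (n≥3 : n ≥ 3) →
    ∃[ γ ] (IsBroadcastDominationNumber (C 3 ≤-refl □ C n n≥3) 2 γ
    × + γ ≡ ceiling (+ (2 * n) / 3))
theorem4p1 n n≥3 = γ ,
  ((broadcast n≥3 , broadcast-dominating n≥3 , broadcast-cost n≥3) , minimal) ,
  ceiling-unique (2 * n) 3
    (subst (2 * n ≤_) (*-comm 3 γ) (∑-strength-lower n))
    (subst (_< 2 * n + 3) (*-comm 3 γ) (∑-strength-upper n))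
  where
  γ = ∑ {n} (toℕ ∘ strength)
  minimal : ∀ f → Dominating (C 3 ≤-refl □ C n n≥3) f → γ ≤ cost (C 3 ≤-refl □ C n n≥3) f
  -- Integrality closes the gap: 3γ < 3(cost + 1) gives γ < cost + 1.
  minimal f dom = s≤s⁻¹ (*-cancelˡ-< 3 γ (suc (cost G f)) (begin-strict
    3 * γ                 <⟨ ∑-strength-upper n ⟩
    2 * n + 3             ≤⟨ +-monoˡ-≤ 3 (dominating⇒2n≤3cost n≥3 f dom) ⟩
    3 * cost G f + 3      ≡⟨ +-comm (3 * cost G f) 3 ⟩
    3 + 3 * cost G f      ≡⟨ *-suc 3 (cost G f) ⟨
    3 * suc (cost G f)    ∎))
    where
    open ≤-Reasoning
    G = C 3 ≤-refl □ C n n≥3
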